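{- Let $k,n\ge1$ be integers. For a function $f:[k]\to[n]$ put $w(f)=\prod_{i=1}^n x_{|f^{ -1}(i)|}$. Then $$\Delta_k x_0^{n}=\sum_{f:[k]\to[n]}w(f).$$ Equivalently, for every colored set $(V,\kappa)$ (a finite totally ordered set $V$ with a function $\kappa:V\to\{0,1,\dots,k\}$), the coefficient $(\Delta_kx_0^n)[V,\kappa]$ is equal to the number of pairs $(f,h)$ where $f:[k]\to[n]$ is a function and $h:[n]\to V$ is a bijection such that $\kappa(h(j))=|f^{ -1}(j)|$ for all $j\in[n]$.
   Context: $[n]=\{1,\dots,n\}$. For $m\ge1$, $\mathcal{D}_m=\sum_{j=0}^{m-1}x_{j+1}\partial_j$ with $\partial_j=\partial/\partial x_j$, acting from power series in $x_0,\dots,x_{m-1}$ to power series in $x_0,\dots,x_m$, and $\Delta_k=\mathcal{D}_k\mathcal{D}_{k-1}\cdots\mathcal{D}_1$. For a series written in exponential form $G(x_0,\dots,x_k)=\sum_{\mathbf{m}}g_{\mathbf{m}}\frac{x_0^{m_0}\cdots x_k^{m_k}}{m_0!\cdots m_k!}$, the coefficient $G[V,\kappa]$ is $g_{\mathbf m}$ with $m_i=|\kappa^{ -1}(i)|$. -}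

module Defs where

open import Algebra.Bundles.Raw using (RawSemiring)
import Algebra.Definitions.RawSemiring as RawSemiringDefinitions
open import Data.Bool.Base using (if_then_else_)
open import Data.Fin.Base using (Fin; zero; suc; toℕ; fromℕ<; finToFun)
open import Data.Fin.Properties using (_≟_)
open import Data.Fin.Subset using (Subset; ∣_∣)
open import Data.Fin.Subset.Properties using (∣p∣≤n)
open import Data.Integer.Base using (+_)
open import Data.Nat.Base as ℕ using (ℕ; zero; suc; s≤s; _∸_; _!)
import Data.Nat.Properties as ℕ
open import Data.Product.Base using (_×_; _,_)
open import Data.Rational.Base as ℚ using (ℚ; 0ℚ; 1ℚ)
open import Data.Vec.Base as Vec using (Vec; []; _∷_; _[_]≔_; _[_]%=_)
open import Data.Vec.Properties using (≡-dec)
open import Function.Base using (_∘_)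
open import Function.Bundles using (_↔_; _⤖_; Inverse; Bijection)
open import Level using (Level; 0ℓ; _⊔_)
open import Relation.Binary.Bundles using (Setoid)
open import Relation.Binary.Core using (Rel)
open import Relation.Binary.Structures using (IsTotalOrder)
open import Relation.Binary.PropositionalEquality
  using (_≡_; _≗_; refl; sym; trans; setoid)
open import Relation.Nullary.Decidable using (does)

private
  variable
    c ℓ : Level
    k m n : ℕ

fromℕ : ℕ → ℚ
fromℕ n = + n ℚ./ 1

open RawSemiringDefinitions ℚ.+-*-rawSemiring using () renaming (sum to sumℚ)

------------------------------------------------------------------------
-- Formal power series over ℚ in x₀ , … , xₘ₋₁

-- The exponent vector (α₀ , … , αₘ₋₁) of x₀^α₀ ⋯ xₘ₋₁^αₘ₋₁.
MultiIndex : ℕ → Set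
MultiIndex m = Vec ℕ m

-- G α is the ordinary (not the exponential) coefficient of x^α.
PowerSeries : ℕ → Set
PowerSeries m = MultiIndex m → ℚ

monomial : MultiIndex m → PowerSeries m
monomial α β = if does (≡-dec ℕ._≟_ β α) then 1ℚ else 0ℚ

var : Fin m → PowerSeries m
var j = monomial (Vec.replicate _ 0 [ j ]≔ 1)

_⊕_ : PowerSeries m → PowerSeries m → PowerSeries m
(F ⊕ G) α = F α ℚ.+ G α

-- Cauchy product: (F ⊛ G) α is the sum of F β * G γ over all β + γ = α,
-- splitting one exponent at a time.
_⊛_ : PowerSeries m → PowerSeries m → PowerSeries m
(F ⊛ G) []      = F [] ℚ.* G []
(F ⊛ G) (a ∷ α) = sumℚ {suc a} λ i →
  ((F ∘ (toℕ i ∷_)) ⊛ (G ∘ (a ∸ toℕ i ∷_))) α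

powerSeries-rawSemiring : ℕ → RawSemiring 0ℓ 0ℓ
powerSeries-rawSemiring m = record
  { Carrier = PowerSeries m
  ; _≈_     = _≗_
  ; _+_     = _⊕_
  ; _*_     = _⊛_
  ; 0#      = λ _ → 0ℚ
  ; 1#      = monomial (Vec.replicate m 0)
  }

module _ {m : ℕ} where
  open RawSemiringDefinitions (powerSeries-rawSemiring m) public
    using (sum; product; _^_)

∂ : Fin m → PowerSeries m → PowerSeries m
∂ j G α = fromℕ (suc (Vec.lookup α j)) ℚ.* G (α [ j ]%= suc)

-- A series in x₀ , … , xₘ₋₁ viewed as a series in x₀ , … , xₘ.
extend : PowerSeries m → PowerSeries (suc m)
extend G α = if does (Vec.last α ℕ.≟ 0) then G (Vec.init α) else 0ℚ

𝒟 : ∀ m → PowerSeries m → PowerSeries (suc m)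
𝒟 m G = sum {n = m} λ j → var (suc j) ⊛ extend (∂ j G)

Δ : ∀ k → PowerSeries 1 → PowerSeries (suc k)
Δ zero    G = G
Δ (suc k) G = 𝒟 (suc k) (Δ k G)

-- The g_α in G = Σ_α g_α x^α / (α₀! ⋯ αₘ₋₁!).
expCoefficient : PowerSeries m → MultiIndex m → ℚ
expCoefficient G α = fromℕ (Vec.foldr′ ℕ._*_ 1 (Vec.map _! α)) ℚ.* G α

------------------------------------------------------------------------
-- Functions [k] → [n] and their weights

fibre : (Fin k → Fin n) → Fin n → Subset k
fibre f i = Vec.tabulate λ j → does (f j ≟ i)

fibreSize : (Fin k → Fin n) → Fin n → Fin (suc k)
fibreSize f i = fromℕ< (s≤s (∣p∣≤n (fibre f i)))

weight : (Fin k → Fin n) → PowerSeries (suc k)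
weight f = product λ i → var (fibreSize f i)

-- finToFun enumerates the n ^ k functions Fin k → Fin n, each exactly once
-- up to pointwise equality.
sumOverFunctions : ∀ k n → ((Fin k → Fin n) → PowerSeries m) → PowerSeries m
sumOverFunctions k n F = sum {n = n ℕ.^ k} λ i → F (finToFun i)

------------------------------------------------------------------------
-- Colored sets

record ColoredSet (k : ℕ) : Set₁ where
  field
    V            : Set
    _≤_          : Rel V 0ℓ
    isTotalOrder : IsTotalOrder _≡_ _≤_
    size         : ℕ
    finite       : Fin size ↔ V
    κ            : V → Fin (suc k)

  -- The i-th entry is ∣κ⁻¹(i)∣; it does not depend on the enumeration.
  content : MultiIndex (suc k)
  content = Vec.tabulate λ i → ∣ fibre (κ ∘ Inverse.to finite) i ∣

_[[_]] : PowerSeries (suc k) → ColoredSet k → ℚ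
G [[ C ]] = expCoefficient G (ColoredSet.content C)

record Matching (n : ℕ) (C : ColoredSet k) : Set where
  open ColoredSet C
  field
    f          : Fin k → Fin n
    h          : Fin n ⤖ V
    compatible : ∀ j → κ (Bijection.to h j) ≡ fibreSize f j

-- Pairs (f , h) are identified when both functions agree pointwise, so that
-- counting them does not need function extensionality.
matchingSetoid : ℕ → ColoredSet k → Setoid 0ℓ 0ℓ
matchingSetoid n C = record
  { Carrier       = Matching n C
  ; _≈_           = λ p q → f p ≗ f q × to (h p) ≗ to (h q)
  ; isEquivalence = record
    { refl  = (λ _ → refl) , (λ _ → refl)
    ; sym   = λ (e , e′) → (λ x → sym (e x)) , (λ x → sym (e′ x))
    ; trans = λ (d , d′) (e , e′) →
        (λ x → trans (d x) (e x)) , (λ x → trans (d′ x) (e′ x))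
    }
  }
  where
  open Matching
  open Bijection using (to)

HasCardinality : Setoid c ℓ → ℕ → Set (c ⊔ ℓ)
HasCardinality S N = Inverse S (setoid (Fin N))

{-# OPTIONS --safe #-}
-- Every weight w(f) is the monomial x^α with αⱼ the number of i such that
-- |f⁻¹(i)| = j.  Applying xⱼ₊₁∂ⱼ to x_{c(1)} ⋯ x_{c(n)} raises one factor of
-- index j, in all possible ways, so 𝒟 sends this monomial to the sum over i of
-- the monomials with c(i) replaced by c(i) + 1; for c(i) = |f⁻¹(i)| this is the
-- effect of extending f to one more point, with value i.  For the coefficients,
-- the number of colour-preserving bijections h is ∏ⱼ αⱼ! if the colour classes of
-- both sides have the same sizes αⱼ, and 0 otherwise, by recursion on h(1).
module Submission where

open import Algebra.Bundles using (CommutativeRing)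
import Algebra.Properties.CommutativeMonoid.Sum as CommutativeMonoidSum
import Algebra.Properties.Semiring.Sum as SemiringSum
open import Data.Bool.Base using (true; false; if_then_else_)
open import Data.Fin.Base
  using (Fin; zero; suc; toℕ; inject₁; punchIn; combine; finToFun; funToFin; _↑ˡ_; _↑ʳ_)
open import Data.Fin.Permutation
  using (Permutation; _⟨$⟩ʳ_; insert; remove; insert-punchIn; punchIn-permute; refute)
open import Data.Fin.Properties
  using ( _≟_; toℕ-injective; toℕ-inject₁; toℕ-fromℕ<; +↔⊎; punchIn-injective; punchInᵢ≢i
        ; remQuot-combine; funToFin-finToFin; finToFun-funToFin)
open import Data.Fin.Subset using (Subset; ∣_∣)
open import Data.Integer.Base as ℤ using (+_)
import Data.Integer.Properties as ℤ
open import Data.Nat.Base as ℕ using (ℕ; zero; suc; pred; _!; _≤_)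
open import Data.Nat.Coprimality using (1-coprimeTo) renaming (sym to coprime-sym)
import Data.Nat.Properties as ℕ
open import Data.Product.Base using (Σ; _×_; _,_; ∃-syntax; ∃₂; proj₁; proj₂)
open import Data.Rational.Base as ℚ using (ℚ; 0ℚ; 1ℚ; mkℚ)
import Data.Rational.Properties as ℚ
open import Data.Sum.Base using (inj₁; inj₂)
open import Data.Vec.Base as Vec using ([]; _∷_; _∷ʳ_; _[_]%=_; lookup; tabulate)
open import Data.Vec.Properties
  using ( ≡-dec; ∷-injectiveˡ; ∷-injectiveʳ; ∷ʳ-injectiveˡ; ∷ʳ-injectiveʳ; init-∷ʳ; last-∷ʳ
        ; lookup∘tabulate; lookup∘updateAt; tabulate-cong
        ; updateAt-commutes; updateAt-id; updateAt-updateAt)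
open import Function.Base using (_∘_; id)
open import Function.Bundles using (_⇔_; mk⇔; _↔_; mk↔ₛ′; Inverse; Bijection)
import Function.Construct.Composition as Composition
open import Function.Construct.Identity using (↔-id)
import Function.Construct.Symmetry as Symmetry
open import Function.Properties.Bijection using (⤖⇒↔)
open import Function.Properties.Inverse using (↔⇒⤖)
open import Level using (Level; 0ℓ)
open import Relation.Binary.Bundles using (Setoid)
import Relation.Binary.Construct.On as On
open import Relation.Binary.PropositionalEquality
open import Relation.Nullary.Decidable
  using (Dec; does; yes; no; dec-true; dec-false; does-⇔)
open import Relation.Nullary.Negation using (¬_; contradiction)
open import Defs

open SemiringSum (CommutativeRing.semiring ℚ.+-*-commutativeRing) using ()
  renaming ( sum to sumℚ; *-distribˡ-sum to *-distribˡ-sumℚ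
           ; sum-cong-≗ to sumℚ-cong; sum-replicate-zero to sumℚ-zero)
open CommutativeMonoidSum ℚ.+-0-commutativeMonoid using ()
  renaming (∑-comm to sumℚ-comm; ∑-distrib-+ to sumℚ-distrib-+)
open SemiringSum ℕ.+-*-semiring using ()
  renaming (sum to sumℕ; sum-cong-≗ to sumℕ-cong; sum-replicate-zero to sumℕ-zero)

open ≡-Reasoning

private
  variable
    a ℓ : Level
    A : Set a
    k m n p : ℕ

fromℕ≡mkℚ : ∀ n → fromℕ n ≡ mkℚ (+ n) 0 (coprime-sym (1-coprimeTo n))
fromℕ≡mkℚ n = ℚ.normalize-coprime (coprime-sym (1-coprimeTo n))

fromℕ-+ : ∀ m n → fromℕ (m ℕ.+ n) ≡ fromℕ m ℚ.+ fromℕ n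
fromℕ-+ m n rewrite fromℕ≡mkℚ m | fromℕ≡mkℚ n =
  cong (ℚ._/ 1) (sym (cong₂ ℤ._+_ (ℤ.*-identityʳ (+ m)) (ℤ.*-identityʳ (+ n))))

%=suc-injective : ∀ (i : Fin m) {α β : MultiIndex m} →
                  α [ i ]%= suc ≡ β [ i ]%= suc → α ≡ β
%=suc-injective zero    {_ ∷ _} {_ ∷ _} refl = refl
%=suc-injective (suc i) {_ ∷ _} {_ ∷ _} eq   =
  cong₂ _∷_ (∷-injectiveˡ eq) (%=suc-injective i (∷-injectiveʳ eq))

%=suc-≢ : ∀ (i : Fin m) {α β : MultiIndex m} → lookup α i ≡ 0 → α ≢ β [ i ]%= suc
%=suc-≢ i {β = β} αᵢ≡0 refl with () ← trans (sym αᵢ≡0) (lookup∘updateAt i β)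

data ExponentView (i : Fin m) : MultiIndex m → Set where
  vanishing : ∀ {α} → lookup α i ≡ 0 → ExponentView i α
  raised    : ∀ α → ExponentView i (α [ i ]%= suc)

exponentView : ∀ (i : Fin m) α → ExponentView i α
exponentView zero    (zero  ∷ α) = vanishing refl
exponentView zero    (suc a ∷ α) = raised (a ∷ α)
exponentView (suc i) (a ∷ α) with exponentView i α
... | vanishing αᵢ≡0 = vanishing αᵢ≡0
... | raised β       = raised (a ∷ β)

%=suc-∷ʳ : ∀ (i : Fin m) α → (α [ i ]%= suc) ∷ʳ 0 ≡ (α ∷ʳ 0) [ inject₁ i ]%= suc
%=suc-∷ʳ zero    (a ∷ α) = refl
%=suc-∷ʳ (suc i) (a ∷ α) = cong (a ∷_) (%=suc-∷ʳ i α)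

data LastExponentView : MultiIndex (suc m) → Set where
  zeroLast    : ∀ (α : MultiIndex m) → LastExponentView (α ∷ʳ 0)
  nonzeroLast : ∀ (α : MultiIndex m) a → LastExponentView (α ∷ʳ suc a)

lastExponentView : ∀ (α : MultiIndex (suc m)) → LastExponentView α
lastExponentView (zero  ∷ []) = zeroLast []
lastExponentView (suc a ∷ []) = nonzeroLast [] a
lastExponentView (a ∷ α@(_ ∷ _)) = cons (lastExponentView α)
  where
  cons : ∀ {m a} {α : MultiIndex (suc m)} → LastExponentView α → LastExponentView (a ∷ α)
  cons (zeroLast β)      = zeroLast (_ ∷ β)
  cons (nonzeroLast β b) = nonzeroLast (_ ∷ β) b

monomial-≡ : ∀ (α : MultiIndex m) → monomial α α ≡ 1ℚ
monomial-≡ α = cong (if_then 1ℚ else 0ℚ) (dec-true (≡-dec ℕ._≟_ α α) refl)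

monomial-≢ : ∀ (α β : MultiIndex m) → β ≢ α → monomial α β ≡ 0ℚ
monomial-≢ α β β≢α =
  cong (if_then 1ℚ else 0ℚ) (dec-false (≡-dec ℕ._≟_ β α) β≢α)

monomial-⇔ : ∀ (α β : MultiIndex m) (γ δ : MultiIndex n) → (β ≡ α ⇔ δ ≡ γ) →
             monomial α β ≡ monomial γ δ
monomial-⇔ α β γ δ eqv =
  cong (if_then 1ℚ else 0ℚ) (does-⇔ eqv (≡-dec ℕ._≟_ β α) (≡-dec ℕ._≟_ δ γ))

monomial-%=suc : ∀ (i : Fin m) α β →
                 monomial (α [ i ]%= suc) (β [ i ]%= suc) ≡ monomial α β
monomial-%=suc i α β =
  monomial-⇔ (α [ i ]%= suc) (β [ i ]%= suc) α β (mk⇔ (%=suc-injective i) (cong (_[ i ]%= suc)))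

monomial-∷ʳ : ∀ (α β : MultiIndex m) → monomial (α ∷ʳ 0) (β ∷ʳ 0) ≡ monomial α β
monomial-∷ʳ α β = monomial-⇔ (α ∷ʳ 0) (β ∷ʳ 0) α β (mk⇔ (∷ʳ-injectiveˡ β α) (cong (_∷ʳ 0)))

-- Multiplication by a variable

sumℚ-≡0 : ∀ (f : Fin n → ℚ) → (∀ i → f i ≡ 0ℚ) → sumℚ f ≡ 0ℚ
sumℚ-≡0 {n} f f≡0 = trans (sumℚ-cong {n} {f} {λ _ → 0ℚ} f≡0) (sumℚ-zero n)

sumℚ-head : ∀ (f : Fin (suc n) → ℚ) → (∀ i → f (suc i) ≡ 0ℚ) → sumℚ f ≡ f zero
sumℚ-head f f≡0 =
  trans (cong (f zero ℚ.+_) (sumℚ-≡0 (f ∘ suc) f≡0)) (ℚ.+-identityʳ (f zero))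

⊛-summand : PowerSeries (suc m) → PowerSeries (suc m) → ∀ a → MultiIndex m → Fin (suc a) → ℚ
⊛-summand F G a α i = ((F ∘ (toℕ i ∷_)) ⊛ (G ∘ (a ℕ.∸ toℕ i ∷_))) α

⊛-zeroˡ : ∀ (G : PowerSeries m) α → ((λ _ → 0ℚ) ⊛ G) α ≡ 0ℚ
⊛-zeroˡ G []      = ℚ.*-zeroˡ (G [])
⊛-zeroˡ G (a ∷ α) =
  sumℚ-≡0 (⊛-summand (λ _ → 0ℚ) G a α) λ i → ⊛-zeroˡ (G ∘ (a ℕ.∸ toℕ i ∷_)) α

⊛-identityˡ : ∀ (G : PowerSeries m) → monomial (Vec.replicate m 0) ⊛ G ≗ G
⊛-identityˡ         G []      = ℚ.*-identityˡ (G [])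
⊛-identityˡ {suc m} G (a ∷ α) = trans
  (sumℚ-head (⊛-summand (monomial (Vec.replicate (suc m) 0)) G a α)
    λ i → ⊛-zeroˡ (G ∘ (a ℕ.∸ suc (toℕ i) ∷_)) α)
  (⊛-identityˡ (G ∘ (a ∷_)) α)

var-⊛-raised : ∀ (i : Fin m) G α → (var i ⊛ G) (α [ i ]%= suc) ≡ G α
var-⊛-raised zero    G (a ∷ α) = begin
  (var zero ⊛ G) (suc a ∷ α)
    ≡⟨ cong (ℚ._+ sumℚ (⊛-summand (var zero) G (suc a) α ∘ suc)) (⊛-zeroˡ (G ∘ (suc a ∷_)) α) ⟩
  0ℚ ℚ.+ sumℚ (⊛-summand (var zero) G (suc a) α ∘ suc)
    ≡⟨ ℚ.+-identityˡ (sumℚ (⊛-summand (var zero) G (suc a) α ∘ suc)) ⟩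
  sumℚ (⊛-summand (var zero) G (suc a) α ∘ suc)
    ≡⟨ sumℚ-head (⊛-summand (var zero) G (suc a) α ∘ suc)
         (λ i → ⊛-zeroˡ (G ∘ (a ℕ.∸ suc (toℕ i) ∷_)) α) ⟩
  (monomial (Vec.replicate _ 0) ⊛ (G ∘ (a ∷_))) α
    ≡⟨ ⊛-identityˡ (G ∘ (a ∷_)) α ⟩
  G (a ∷ α) ∎
var-⊛-raised (suc i) G (a ∷ α) = trans
  (sumℚ-head (⊛-summand (var (suc i)) G a (α [ i ]%= suc))
    λ j → ⊛-zeroˡ (G ∘ (a ℕ.∸ suc (toℕ j) ∷_)) (α [ i ]%= suc))
  (var-⊛-raised i (G ∘ (a ∷_)) α)

var-⊛-vanishing : ∀ (i : Fin m) G α → lookup α i ≡ 0 → (var i ⊛ G) α ≡ 0ℚ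
var-⊛-vanishing zero    G (zero ∷ α) refl =
  sumℚ-≡0 (⊛-summand (var zero) G 0 α) λ { zero → ⊛-zeroˡ (G ∘ (0 ∷_)) α }
var-⊛-vanishing (suc i) G (a ∷ α) αᵢ≡0 = trans
  (sumℚ-head (⊛-summand (var (suc i)) G a α)
    λ j → ⊛-zeroˡ (G ∘ (a ℕ.∸ suc (toℕ j) ∷_)) α)
  (var-⊛-vanishing i (G ∘ (a ∷_)) α αᵢ≡0)

var-⊛-monomial : ∀ (i : Fin m) {G α} → G ≗ monomial α →
                 var i ⊛ G ≗ monomial (α [ i ]%= suc)
var-⊛-monomial i {G} {α} G≗ γ with exponentView i γ
... | vanishing γᵢ≡0 =
  trans (var-⊛-vanishing i G γ γᵢ≡0) (sym (monomial-≢ (α [ i ]%= suc) γ (%=suc-≢ i γᵢ≡0)))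
... | raised δ = begin
  (var i ⊛ G) (δ [ i ]%= suc)              ≡⟨ var-⊛-raised i G δ ⟩
  G δ                                       ≡⟨ G≗ δ ⟩
  monomial α δ                              ≡⟨ monomial-%=suc i α δ ⟨
  monomial (α [ i ]%= suc) (δ [ i ]%= suc) ∎

-- The operators 𝒟

extend-∷ʳ-zero : ∀ (G : PowerSeries m) α → extend G (α ∷ʳ 0) ≡ G α
extend-∷ʳ-zero G α rewrite last-∷ʳ 0 α | init-∷ʳ 0 α = refl

extend-∷ʳ-suc : ∀ (G : PowerSeries m) α a → extend G (α ∷ʳ suc a) ≡ 0ℚ
extend-∷ʳ-suc G α a rewrite last-∷ʳ (suc a) α = refl

𝒟-term : Fin m → PowerSeries m → PowerSeries (suc m)
𝒟-term j G = var (suc j) ⊛ extend (∂ j G)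

-- q and δ do not depend on G, hence the linearity of 𝒟.
𝒟-term-coefficient : ∀ (j : Fin m) γ →
  ∃₂ λ q δ → ∀ G → 𝒟-term j G γ ≡ q ℚ.* G δ
𝒟-term-coefficient j γ with exponentView (suc j) γ
... | vanishing γⱼ≡0 = 0ℚ , Vec.replicate _ 0 , λ G →
  trans (var-⊛-vanishing (suc j) (extend (∂ j G)) γ γⱼ≡0)
        (sym (ℚ.*-zeroˡ (G (Vec.replicate _ 0))))
... | raised δ with lastExponentView δ
...   | zeroLast ε = fromℕ (suc (lookup ε j)) , ε [ j ]%= suc , λ G →
  trans (var-⊛-raised (suc j) (extend (∂ j G)) (ε ∷ʳ 0)) (extend-∷ʳ-zero (∂ j G) ε)
...   | nonzeroLast ε a = 0ℚ , Vec.replicate _ 0 , λ G →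
  trans (trans (var-⊛-raised (suc j) (extend (∂ j G)) (ε ∷ʳ suc a)) (extend-∷ʳ-suc (∂ j G) ε a))
        (sym (ℚ.*-zeroˡ (G (Vec.replicate _ 0))))

sum-coefficient : ∀ (F : Fin n → PowerSeries m) γ → sum F γ ≡ sumℚ λ i → F i γ
sum-coefficient {n = zero}  F γ = refl
sum-coefficient {n = suc n} F γ = cong (F zero γ ℚ.+_) (sum-coefficient (F ∘ suc) γ)

𝒟-cong : ∀ {F G : PowerSeries m} → F ≗ G → 𝒟 m F ≗ 𝒟 m G
𝒟-cong {m} {F} {G} F≗G γ = begin
  𝒟 m F γ                        ≡⟨ sum-coefficient {n = m} (λ j → 𝒟-term j F) γ ⟩
  sumℚ (λ j → 𝒟-term j F γ)      ≡⟨ sumℚ-cong termwise ⟩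
  sumℚ (λ j → 𝒟-term j G γ)      ≡⟨ sum-coefficient {n = m} (λ j → 𝒟-term j G) γ ⟨
  𝒟 m G γ                        ∎
  where
  termwise : ∀ j → 𝒟-term j F γ ≡ 𝒟-term j G γ
  termwise j =
    let q , δ , eq = 𝒟-term-coefficient j γ in
    trans (eq F) (trans (cong (q ℚ.*_) (F≗G δ)) (sym (eq G)))

𝒟-sum : ∀ (F : Fin n → PowerSeries m) γ → 𝒟 m (sum F) γ ≡ sumℚ λ i → 𝒟 m (F i) γ
𝒟-sum {n} {m} F γ = begin
  𝒟 m (sum F) γ
    ≡⟨ sum-coefficient {n = m} (λ j → 𝒟-term j (sum F)) γ ⟩
  sumℚ (λ j → 𝒟-term j (sum F) γ)           ≡⟨ sumℚ-cong termwise ⟩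
  sumℚ (λ j → sumℚ (λ i → 𝒟-term j (F i) γ)) ≡⟨ sumℚ-comm (λ j i → 𝒟-term j (F i) γ) ⟩
  sumℚ (λ i → sumℚ (λ j → 𝒟-term j (F i) γ))
    ≡⟨ sumℚ-cong (λ i → sum-coefficient {n = m} (λ j → 𝒟-term j (F i)) γ) ⟨
  sumℚ (λ i → 𝒟 m (F i) γ)                  ∎
  where
  termwise : ∀ j → 𝒟-term j (sum F) γ ≡ sumℚ (λ i → 𝒟-term j (F i) γ)
  termwise j = let q , δ , eq = 𝒟-term-coefficient j γ in begin
    𝒟-term j (sum F) γ             ≡⟨ eq (sum F) ⟩
    q ℚ.* sum F δ                  ≡⟨ cong (q ℚ.*_) (sum-coefficient F δ) ⟩
    q ℚ.* sumℚ (λ i → F i δ)       ≡⟨ *-distribˡ-sumℚ q (λ i → F i δ) ⟩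
    sumℚ (λ i → q ℚ.* F i δ)       ≡⟨ sumℚ-cong (λ i → eq (F i)) ⟨
    sumℚ (λ i → 𝒟-term j (F i) γ)  ∎

-- The exponent vector of x^α · xⱼ₊₁ / xⱼ; a junk value if αⱼ = 0, when its
-- coefficient αⱼ vanishes.
advance : Fin m → MultiIndex m → MultiIndex (suc m)
advance j α = ((α ∷ʳ 0) [ inject₁ j ]%= pred) [ suc j ]%= suc

advance-%=suc : ∀ (j : Fin m) α → advance j (α [ j ]%= suc) ≡ (α ∷ʳ 0) [ suc j ]%= suc
advance-%=suc j α = cong (_[ suc j ]%= suc) (begin
  ((α [ j ]%= suc) ∷ʳ 0) [ inject₁ j ]%= pred
    ≡⟨ cong (_[ inject₁ j ]%= pred) (%=suc-∷ʳ j α) ⟩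
  ((α ∷ʳ 0) [ inject₁ j ]%= suc) [ inject₁ j ]%= pred
    ≡⟨ updateAt-updateAt (inject₁ j) (α ∷ʳ 0) ⟩
  (α ∷ʳ 0) [ inject₁ j ]%= id                          ≡⟨ updateAt-id (inject₁ j) (α ∷ʳ 0) ⟩
  α ∷ʳ 0                                               ∎)

extend-∂-monomial : ∀ (j : Fin m) β δ →
  extend (∂ j (monomial (β [ j ]%= suc))) δ
    ≡ fromℕ (suc (lookup β j)) ℚ.* monomial (β ∷ʳ 0) δ
extend-∂-monomial j β δ with lastExponentView δ
... | nonzeroLast ε a = begin
  extend (∂ j (monomial (β [ j ]%= suc))) (ε ∷ʳ suc a)
    ≡⟨ extend-∷ʳ-suc (∂ j (monomial (β [ j ]%= suc))) ε a ⟩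
  0ℚ                                                   ≡⟨ ℚ.*-zeroʳ c ⟨
  c ℚ.* 0ℚ
    ≡⟨ cong (c ℚ.*_) (monomial-≢ (β ∷ʳ 0) (ε ∷ʳ suc a) (ℕ.1+n≢0 ∘ ∷ʳ-injectiveʳ ε β)) ⟨
  c ℚ.* monomial (β ∷ʳ 0) (ε ∷ʳ suc a)                 ∎
  where c = fromℕ (suc (lookup β j))
... | zeroLast ε with ≡-dec ℕ._≟_ ε β
...   | yes refl = begin
  extend (∂ j (monomial (β [ j ]%= suc))) (β ∷ʳ 0)
    ≡⟨ extend-∷ʳ-zero (∂ j (monomial (β [ j ]%= suc))) β ⟩
  c ℚ.* monomial (β [ j ]%= suc) (β [ j ]%= suc)     ≡⟨ cong (c ℚ.*_) (monomial-%=suc j β β) ⟩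
  c ℚ.* monomial β β                                 ≡⟨ cong (c ℚ.*_) (monomial-∷ʳ β β) ⟨
  c ℚ.* monomial (β ∷ʳ 0) (β ∷ʳ 0)                   ∎
  where c = fromℕ (suc (lookup β j))
...   | no ε≢β = begin
  extend (∂ j (monomial (β [ j ]%= suc))) (ε ∷ʳ 0)
    ≡⟨ extend-∷ʳ-zero (∂ j (monomial (β [ j ]%= suc))) ε ⟩
  c ℚ.* monomial (β [ j ]%= suc) (ε [ j ]%= suc)
    ≡⟨ cong (c ℚ.*_) (monomial-≢ (β [ j ]%= suc) (ε [ j ]%= suc) (ε≢β ∘ %=suc-injective j)) ⟩
  c ℚ.* 0ℚ                                           ≡⟨ ℚ.*-zeroʳ c ⟩
  0ℚ                                                 ≡⟨ ℚ.*-zeroʳ d ⟨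
  d ℚ.* 0ℚ
    ≡⟨ cong (d ℚ.*_) (monomial-≢ (β ∷ʳ 0) (ε ∷ʳ 0) (ε≢β ∘ ∷ʳ-injectiveˡ ε β)) ⟨
  d ℚ.* monomial (β ∷ʳ 0) (ε ∷ʳ 0)                   ∎
  where
  c = fromℕ (suc (lookup ε j))
  d = fromℕ (suc (lookup β j))

extend-∂-monomial-vanishing : ∀ (j : Fin m) {α} → lookup α j ≡ 0 → ∀ δ →
  extend (∂ j (monomial α)) δ ≡ 0ℚ
extend-∂-monomial-vanishing j {α} αⱼ≡0 δ with lastExponentView δ
... | nonzeroLast ε a = extend-∷ʳ-suc (∂ j (monomial α)) ε a
... | zeroLast ε = begin
  extend (∂ j (monomial α)) (ε ∷ʳ 0)  ≡⟨ extend-∷ʳ-zero (∂ j (monomial α)) ε ⟩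
  c ℚ.* monomial α (ε [ j ]%= suc)
    ≡⟨ cong (c ℚ.*_) (monomial-≢ α (ε [ j ]%= suc) (%=suc-≢ j αⱼ≡0 ∘ sym)) ⟩
  c ℚ.* 0ℚ                            ≡⟨ ℚ.*-zeroʳ c ⟩
  0ℚ                                  ∎
  where c = fromℕ (suc (lookup ε j))

𝒟-term-monomial : ∀ (j : Fin m) α γ →
  𝒟-term j (monomial α) γ ≡ fromℕ (lookup α j) ℚ.* monomial (advance j α) γ
𝒟-term-monomial j α γ with exponentView (suc j) γ
... | vanishing γⱼ≡0 = begin
  𝒟-term j (monomial α) γ
    ≡⟨ var-⊛-vanishing (suc j) (extend (∂ j (monomial α))) γ γⱼ≡0 ⟩
  0ℚ                                   ≡⟨ ℚ.*-zeroʳ c ⟨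
  c ℚ.* 0ℚ
    ≡⟨ cong (c ℚ.*_) (monomial-≢ (advance j α) γ (%=suc-≢ (suc j) γⱼ≡0)) ⟨
  c ℚ.* monomial (advance j α) γ       ∎
  where c = fromℕ (lookup α j)
... | raised δ with exponentView j α
...   | vanishing αⱼ≡0 = begin
  𝒟-term j (monomial α) δ⁺              ≡⟨ var-⊛-raised (suc j) (extend (∂ j (monomial α))) δ ⟩
  extend (∂ j (monomial α)) δ           ≡⟨ extend-∂-monomial-vanishing j αⱼ≡0 δ ⟩
  0ℚ                                    ≡⟨ ℚ.*-zeroˡ (monomial (advance j α) δ⁺) ⟨
  0ℚ ℚ.* monomial (advance j α) δ⁺
    ≡⟨ cong (λ a → fromℕ a ℚ.* monomial (advance j α) δ⁺) αⱼ≡0 ⟨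
  fromℕ (lookup α j) ℚ.* monomial (advance j α) δ⁺ ∎
  where δ⁺ = δ [ suc j ]%= suc
...   | raised β = begin
  𝒟-term j (monomial (β [ j ]%= suc)) δ⁺
    ≡⟨ var-⊛-raised (suc j) (extend (∂ j (monomial (β [ j ]%= suc)))) δ ⟩
  extend (∂ j (monomial (β [ j ]%= suc))) δ  ≡⟨ extend-∂-monomial j β δ ⟩
  c ℚ.* monomial (β ∷ʳ 0) δ
    ≡⟨ cong (c ℚ.*_) (monomial-%=suc (suc j) (β ∷ʳ 0) δ) ⟨
  c ℚ.* monomial ((β ∷ʳ 0) [ suc j ]%= suc) δ⁺
    ≡⟨ cong₂ (λ a α′ → fromℕ a ℚ.* monomial α′ δ⁺)
         (lookup∘updateAt j β) (advance-%=suc j β) ⟨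
  fromℕ (lookup (β [ j ]%= suc) j) ℚ.* monomial (advance j (β [ j ]%= suc)) δ⁺ ∎
  where
  δ⁺ = δ [ suc j ]%= suc
  c = fromℕ (suc (lookup β j))

-- Sizes of fibres

fibreSizes : (Fin n → Fin m) → MultiIndex m
fibreSizes c = tabulate λ i → ∣ fibre c i ∣

fibre-cong : ∀ {c d : Fin n → Fin m} → c ≗ d → fibre c ≗ fibre d
fibre-cong c≗d i = tabulate-cong λ j → cong (λ x → does (x ≟ i)) (c≗d j)

fibreSizes-cong : ∀ {c d : Fin n → Fin m} → c ≗ d → fibreSizes c ≡ fibreSizes d
fibreSizes-cong c≗d = tabulate-cong λ i → cong ∣_∣ (fibre-cong c≗d i)

tabulate-∣∷∣ : ∀ (i : Fin m) (s : Fin m → Subset n) →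
  tabulate (λ j → ∣ does (i ≟ j) ∷ s j ∣) ≡ tabulate (λ j → ∣ s j ∣) [ i ]%= suc
tabulate-∣∷∣ zero    s = refl
tabulate-∣∷∣ (suc i) s = cong (_ ∷_) (tabulate-∣∷∣ i (s ∘ suc))

fibreSizes-suc : ∀ (c : Fin (suc n) → Fin m) →
                 fibreSizes c ≡ fibreSizes (c ∘ suc) [ c zero ]%= suc
fibreSizes-suc c = tabulate-∣∷∣ (c zero) (fibre (c ∘ suc))

%=suc-comm : ∀ (i j : Fin m) (α : MultiIndex m) →
             (α [ i ]%= suc) [ j ]%= suc ≡ (α [ j ]%= suc) [ i ]%= suc
%=suc-comm i j α with j ≟ i
... | yes refl = refl
... | no j≢i   = updateAt-commutes j i j≢i α

fibreSizes-punchIn : ∀ (c : Fin (suc n) → Fin m) i →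
                     fibreSizes c ≡ fibreSizes (c ∘ punchIn i) [ c i ]%= suc
fibreSizes-punchIn         c zero    = fibreSizes-suc c
fibreSizes-punchIn {suc n} c (suc i) = begin
  fibreSizes c
    ≡⟨ fibreSizes-suc c ⟩
  fibreSizes (c ∘ suc) [ c zero ]%= suc
    ≡⟨ cong (_[ c zero ]%= suc) (fibreSizes-punchIn (c ∘ suc) i) ⟩
  (fibreSizes (c ∘ suc ∘ punchIn i) [ c (suc i) ]%= suc) [ c zero ]%= suc
    ≡⟨ %=suc-comm (c (suc i)) (c zero) (fibreSizes (c ∘ suc ∘ punchIn i)) ⟩
  (fibreSizes (c ∘ suc ∘ punchIn i) [ c zero ]%= suc) [ c (suc i) ]%= suc
    ≡⟨ cong (_[ c (suc i) ]%= suc) (fibreSizes-suc (c ∘ punchIn (suc i))) ⟨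
  fibreSizes (c ∘ punchIn (suc i)) [ c (suc i) ]%= suc ∎

tabulate-0-∷ʳ : ∀ m → tabulate {n = suc m} (λ _ → 0) ≡ tabulate {n = m} (λ _ → 0) ∷ʳ 0
tabulate-0-∷ʳ zero    = refl
tabulate-0-∷ʳ (suc m) = cong (0 ∷_) (tabulate-0-∷ʳ m)

fibreSizes-inject₁ : ∀ (c : Fin n → Fin m) →
                     fibreSizes (inject₁ ∘ c) ≡ fibreSizes c ∷ʳ 0
fibreSizes-inject₁ {zero}  {m} c = tabulate-0-∷ʳ m
fibreSizes-inject₁ {suc n} c = begin
  fibreSizes (inject₁ ∘ c)
    ≡⟨ fibreSizes-suc (inject₁ ∘ c) ⟩
  fibreSizes (inject₁ ∘ c ∘ suc) [ inject₁ (c zero) ]%= suc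
    ≡⟨ cong (_[ inject₁ (c zero) ]%= suc) (fibreSizes-inject₁ (c ∘ suc)) ⟩
  (fibreSizes (c ∘ suc) ∷ʳ 0) [ inject₁ (c zero) ]%= suc
    ≡⟨ %=suc-∷ʳ (c zero) (fibreSizes (c ∘ suc)) ⟨
  (fibreSizes (c ∘ suc) [ c zero ]%= suc) ∷ʳ 0
    ≡⟨ cong (_∷ʳ 0) (fibreSizes-suc c) ⟨
  fibreSizes c ∷ʳ 0 ∎

promote : Fin n → (Fin n → Fin m) → Fin n → Fin (suc m)
promote i c j = if does (i ≟ j) then suc (c j) else inject₁ (c j)

promote-≡ : ∀ (i : Fin n) (c : Fin n → Fin m) → promote i c i ≡ suc (c i)
promote-≡ i c rewrite dec-true (i ≟ i) refl = refl

promote-punchIn : ∀ i (c : Fin (suc n) → Fin m) →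
                  promote i c ∘ punchIn i ≗ inject₁ ∘ c ∘ punchIn i
promote-punchIn i c j
  rewrite dec-false (i ≟ punchIn i j) (punchInᵢ≢i i j ∘ sym) = refl

fibreSizes-promote : ∀ (i : Fin n) (c : Fin n → Fin m) →
                     advance (c i) (fibreSizes c) ≡ fibreSizes (promote i c)
fibreSizes-promote {n = suc n} i c = begin
  advance (c i) (fibreSizes c)
    ≡⟨ cong (advance (c i)) (fibreSizes-punchIn c i) ⟩
  advance (c i) (fibreSizes (c ∘ punchIn i) [ c i ]%= suc)
    ≡⟨ advance-%=suc (c i) (fibreSizes (c ∘ punchIn i)) ⟩
  (fibreSizes (c ∘ punchIn i) ∷ʳ 0) [ suc (c i) ]%= suc
    ≡⟨ cong (_[ suc (c i) ]%= suc)
         (trans (fibreSizes-cong (promote-punchIn i c)) (fibreSizes-inject₁ (c ∘ punchIn i))) ⟨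
  fibreSizes (promote i c ∘ punchIn i) [ suc (c i) ]%= suc
    ≡⟨ cong (fibreSizes (promote i c ∘ punchIn i) [_]%= suc) (promote-≡ i c) ⟨
  fibreSizes (promote i c ∘ punchIn i) [ promote i c i ]%= suc
    ≡⟨ fibreSizes-punchIn (promote i c) i ⟨
  fibreSizes (promote i c) ∎

sumℚ-select : ∀ (i : Fin m) (g : Fin m → ℚ) →
              sumℚ (λ j → if does (i ≟ j) then g j else 0ℚ) ≡ g i
sumℚ-select {suc m} zero    g =
  trans (cong (g zero ℚ.+_) (sumℚ-zero m)) (ℚ.+-identityʳ (g zero))
sumℚ-select (suc i) g = trans (ℚ.+-identityˡ _) (sumℚ-select i (g ∘ suc))

fromℕ-∣∷∣-* : ∀ b (s : Subset n) x →
  fromℕ ∣ b ∷ s ∣ ℚ.* x ≡ (if b then x else 0ℚ) ℚ.+ fromℕ ∣ s ∣ ℚ.* x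
fromℕ-∣∷∣-* false s x = sym (ℚ.+-identityˡ _)
fromℕ-∣∷∣-* true  s x = begin
  fromℕ (suc ∣ s ∣) ℚ.* x             ≡⟨ cong (ℚ._* x) (fromℕ-+ 1 ∣ s ∣) ⟩
  (1ℚ ℚ.+ fromℕ ∣ s ∣) ℚ.* x          ≡⟨ ℚ.*-distribʳ-+ x 1ℚ (fromℕ ∣ s ∣) ⟩
  1ℚ ℚ.* x ℚ.+ fromℕ ∣ s ∣ ℚ.* x      ≡⟨ cong (ℚ._+ fromℕ ∣ s ∣ ℚ.* x) (ℚ.*-identityˡ x) ⟩
  x ℚ.+ fromℕ ∣ s ∣ ℚ.* x             ∎

sumℚ-fibres : ∀ (c : Fin n → Fin m) (g : Fin m → ℚ) →
              sumℚ (λ j → fromℕ ∣ fibre c j ∣ ℚ.* g j) ≡ sumℚ (g ∘ c)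
sumℚ-fibres {zero}  {m} c g = trans (sumℚ-cong λ j → ℚ.*-zeroˡ (g j)) (sumℚ-zero m)
sumℚ-fibres {suc n} c g = begin
  sumℚ (λ j → fromℕ ∣ fibre c j ∣ ℚ.* g j)
    ≡⟨ sumℚ-cong (λ j → fromℕ-∣∷∣-* (does (c zero ≟ j)) (fibre (c ∘ suc) j) (g j)) ⟩
  sumℚ (λ j → (if does (c zero ≟ j) then g j else 0ℚ) ℚ.+ fromℕ ∣ fibre (c ∘ suc) j ∣ ℚ.* g j)
    ≡⟨ sumℚ-distrib-+ (λ j → if does (c zero ≟ j) then g j else 0ℚ) _ ⟩
  sumℚ (λ j → if does (c zero ≟ j) then g j else 0ℚ) 
    ℚ.+ sumℚ (λ j → fromℕ ∣ fibre (c ∘ suc) j ∣ ℚ.* g j)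
    ≡⟨ cong₂ ℚ._+_ (sumℚ-select (c zero) g) (sumℚ-fibres (c ∘ suc) g) ⟩
  g (c zero) ℚ.+ sumℚ (g ∘ c ∘ suc) ∎

𝒟-monomial : ∀ (c : Fin n → Fin m) γ →
  𝒟 m (monomial (fibreSizes c)) γ ≡ sumℚ λ i → monomial (fibreSizes (promote i c)) γ
𝒟-monomial {m = m} c γ = begin
  𝒟 m (monomial (fibreSizes c)) γ
    ≡⟨ sum-coefficient {n = m} (λ j → 𝒟-term j (monomial (fibreSizes c))) γ ⟩
  sumℚ (λ j → 𝒟-term j (monomial (fibreSizes c)) γ)
    ≡⟨ sumℚ-cong (λ j → 𝒟-term-monomial j (fibreSizes c) γ) ⟩
  sumℚ (λ j → fromℕ (lookup (fibreSizes c) j) ℚ.* monomial (advance j (fibreSizes c)) γ)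
    ≡⟨ sumℚ-cong (λ j → cong (λ a → fromℕ a ℚ.* monomial (advance j (fibreSizes c)) γ)
         (lookup∘tabulate (λ j → ∣ fibre c j ∣) j)) ⟩
  sumℚ (λ j → fromℕ ∣ fibre c j ∣ ℚ.* monomial (advance j (fibreSizes c)) γ)
    ≡⟨ sumℚ-fibres c (λ j → monomial (advance j (fibreSizes c)) γ) ⟩
  sumℚ (λ i → monomial (advance (c i) (fibreSizes c)) γ)
    ≡⟨ sumℚ-cong (λ i → cong (λ α → monomial α γ) (fibreSizes-promote i c)) ⟩
  sumℚ (λ i → monomial (fibreSizes (promote i c)) γ) ∎

product-var : ∀ (c : Fin n → Fin m) → product (var ∘ c) ≗ monomial (fibreSizes c)
product-var {zero}  {m} c γ = cong (λ α → monomial α γ) (replicate≡ m)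
  where
  replicate≡ : ∀ m → Vec.replicate m 0 ≡ tabulate {n = m} λ _ → 0
  replicate≡ zero    = refl
  replicate≡ (suc m) = cong (0 ∷_) (replicate≡ m)
product-var {suc n} c γ = trans
  (var-⊛-monomial (c zero) (product-var (c ∘ suc)) γ)
  (cong (λ α → monomial α γ) (sym (fibreSizes-suc c)))

weightExponents : (Fin k → Fin n) → MultiIndex (suc k)
weightExponents f = fibreSizes (fibreSize f)

weight-monomial : ∀ (f : Fin k → Fin n) → weight f ≗ monomial (weightExponents f)
weight-monomial f = product-var (fibreSize f)

toℕ-fibreSize : ∀ (f : Fin k → Fin n) i → toℕ (fibreSize f i) ≡ ∣ fibre f i ∣
toℕ-fibreSize f i = toℕ-fromℕ< _

fibreSize-cong : ∀ {f g : Fin k → Fin n} → f ≗ g → fibreSize f ≗ fibreSize g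
fibreSize-cong {f = f} {g} f≗g i = toℕ-injective (begin
  toℕ (fibreSize f i) ≡⟨ toℕ-fibreSize f i ⟩
  ∣ fibre f i ∣       ≡⟨ cong ∣_∣ (fibre-cong f≗g i) ⟩
  ∣ fibre g i ∣       ≡⟨ toℕ-fibreSize g i ⟨
  toℕ (fibreSize g i) ∎)

fibreSize-suc : ∀ (f : Fin (suc k) → Fin n) →
                fibreSize f ≗ promote (f zero) (fibreSize (f ∘ suc))
fibreSize-suc f i = toℕ-injective (trans (toℕ-fibreSize f i) lemma)
  where
  lemma : ∣ fibre f i ∣ ≡ toℕ (promote (f zero) (fibreSize (f ∘ suc)) i)
  lemma with does (f zero ≟ i)
  ... | true  = cong suc (sym (toℕ-fibreSize (f ∘ suc) i))
  ... | false = sym (trans (toℕ-inject₁ _) (toℕ-fibreSize (f ∘ suc) i))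

sumℚ-++ : ∀ m n (g : Fin (m ℕ.+ n) → ℚ) →
          sumℚ g ≡ sumℚ (λ i → g (i ↑ˡ n)) ℚ.+ sumℚ (λ j → g (m ↑ʳ j))
sumℚ-++ zero    n g = sym (ℚ.+-identityˡ (sumℚ g))
sumℚ-++ (suc m) n g =
  trans (cong (g zero ℚ.+_) (sumℚ-++ m n (g ∘ suc))) (sym (ℚ.+-assoc (g zero) _ _))

sumℚ-combine : ∀ m n (g : Fin (m ℕ.* n) → ℚ) →
               sumℚ g ≡ sumℚ λ i → sumℚ λ j → g (combine {m} i j)
sumℚ-combine zero    n g = refl
sumℚ-combine (suc m) n g =
  trans (sumℚ-++ n (m ℕ.* n) g)
        (cong (sumℚ (λ j → g (j ↑ˡ (m ℕ.* n))) ℚ.+_) (sumℚ-combine m n (λ i → g (n ↑ʳ i))))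

fibreSize-combine : ∀ (i : Fin n) (j : Fin (n ℕ.^ k)) →
  fibreSize (finToFun {n} {suc k} (combine i j)) ≗ promote i (fibreSize (finToFun j))
fibreSize-combine {n} {k} i j x = trans
  (fibreSize-suc (finToFun {n} {suc k} (combine i j)) x)
  (cong (λ (q , r) → promote q (fibreSize (finToFun {n} {k} r)) x) (remQuot-combine {n} i j))

^≡product : ∀ n (x : PowerSeries m) → x ^ n ≡ product {n = n} (λ _ → x)
^≡product zero    x = refl
^≡product (suc n) x = cong (x ⊛_) (^≡product n x)

Δ-power : ∀ k n → Δ k (var zero ^ n) ≗ sumOverFunctions k n weight
Δ-power zero    n γ = trans
  (cong (λ G → G γ) (^≡product n (var zero)))
  (sym (ℚ.+-identityʳ _))
Δ-power (suc k) n γ = begin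
  𝒟 (suc k) (Δ k (var zero ^ n)) γ
    ≡⟨ 𝒟-cong (Δ-power k n) γ ⟩
  𝒟 (suc k) (sumOverFunctions k n weight) γ
    ≡⟨ 𝒟-sum {n = n ℕ.^ k} (λ j → weight (finToFun j)) γ ⟩
  sumℚ {n ℕ.^ k} (λ j → 𝒟 (suc k) (weight (finToFun j)) γ)
    ≡⟨ sumℚ-cong {n ℕ.^ k} (λ j → trans
         (𝒟-cong (weight-monomial (finToFun j)) γ)
         (𝒟-monomial (fibreSize (finToFun j)) γ)) ⟩
  sumℚ {n ℕ.^ k} (λ j → sumℚ {n} λ i → monomial (fibreSizes (promote i (fibreSize (finToFun j)))) γ)
    ≡⟨ sumℚ-comm {n ℕ.^ k} {n}
         (λ j i → monomial (fibreSizes (promote i (fibreSize (finToFun j)))) γ) ⟩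
  sumℚ {n} (λ i → sumℚ {n ℕ.^ k} λ j → monomial (fibreSizes (promote i (fibreSize (finToFun j)))) γ)
    ≡⟨ sumℚ-cong {n} (λ i → sumℚ-cong {n ℕ.^ k} λ j → trans
         (cong (λ α → monomial α γ) (sym (fibreSizes-cong (fibreSize-combine {n} {k} i j))))
         (sym (weight-monomial (finToFun {n} {suc k} (combine i j)) γ))) ⟩
  sumℚ {n} (λ i → sumℚ {n ℕ.^ k} λ j → weight (finToFun {n} {suc k} (combine i j)) γ)
    ≡⟨ sumℚ-combine n (n ℕ.^ k) (λ i → weight (finToFun {n} {suc k} i) γ) ⟨
  sumℚ {n ℕ.* n ℕ.^ k} (λ i → weight (finToFun {n} {suc k} i) γ)
    ≡⟨ sum-coefficient {n = n ℕ.* n ℕ.^ k} (λ i → weight (finToFun {n} {suc k} i)) γ ⟨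
  sumOverFunctions (suc k) n weight γ ∎

-- Cardinalities of setoids

hasCardinality-empty : ∀ (S : Setoid a ℓ) → ¬ Setoid.Carrier S → HasCardinality S 0
hasCardinality-empty S ¬S = record
  { to        = λ s → contradiction s ¬S
  ; from      = λ ()
  ; to-cong   = λ {s} _ → contradiction s ¬S
  ; from-cong = λ { {()} }
  ; inverse   = (λ { {()} }) , λ {s} _ → contradiction s ¬S
  }

fibreSetoid : (S : Setoid a ℓ) → (Setoid.Carrier S → A) → A → Setoid _ ℓ
fibreSetoid S π x = On.setoid {B = ∃[ s ] π s ≡ x} S proj₁

Fin-sum↔Σ : ∀ (N : Fin p → ℕ) → Fin (sumℕ N) ↔ Σ (Fin p) (Fin ∘ N)
Fin-sum↔Σ {zero}  N = mk↔ₛ′ (λ ()) (λ ()) (λ ()) (λ ())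
Fin-sum↔Σ {suc p} N = Composition.inverse +↔⊎ (mk↔ₛ′
  (λ { (inj₁ y) → zero , y ; (inj₂ y) → let x , z = to y in suc x , z })
  (λ { (zero , y) → inj₁ y ; (suc x , y) → inj₂ (from (x , y)) })
  (λ { (zero , y) → refl
     ; (suc x , y) → cong (λ (x , z) → suc x , z) (strictlyInverseˡ (x , y)) })
  (λ { (inj₁ y) → refl ; (inj₂ y) → cong inj₂ (strictlyInverseʳ y) }))
  where open Inverse (Fin-sum↔Σ {p} (N ∘ suc))

module _ (S : Setoid a ℓ) (π : Setoid.Carrier S → Fin p) where
  open Setoid S using (_≈_) renaming (refl to ≈-refl)

  hasCardinality-sum : (∀ {s t} → s ≈ t → π s ≡ π t) → {N : Fin p → ℕ} →
                       (∀ x → HasCardinality (fibreSetoid S π x) (N x)) →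
                       HasCardinality S (sumℕ N)
  hasCardinality-sum π-cong {N} I =
    Composition.inverse S↔Σ (Symmetry.inverse (Fin-sum↔Σ N))
    where
    to-fibre : ∀ {s x} (πs≡x : π s ≡ x) →
      _≡_ {A = Σ (Fin p) (Fin ∘ N)}
          (π s , Inverse.to (I (π s)) (s , refl)) (x , Inverse.to (I x) (s , πs≡x))
    to-fibre refl = refl

    S↔Σ : Inverse S (setoid (Σ (Fin p) (Fin ∘ N)))
    S↔Σ = record
      { to        = λ s → π s , Inverse.to (I (π s)) (s , refl)
      ; from      = λ (x , y) → proj₁ (Inverse.from (I x) y)
      ; to-cong   = λ {s} {t} s≈t → trans (to-fibre (π-cong s≈t))
          (cong (π t ,_) (Inverse.to-cong (I (π t)) s≈t))
      ; from-cong = λ { refl → ≈-refl }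
      ; inverse   =
          (λ { {x , y} s≈ → trans
             (to-fibre (trans (π-cong s≈) (proj₂ (Inverse.from (I x) y))))
             (cong (x ,_) (Inverse.inverseˡ (I x) s≈)) })
        , (λ { {s} refl → Inverse.inverseʳ (I (π s)) refl })
      }

-- Colour-preserving bijections

record ColorBijection (d : Fin n → Fin m) (e : Fin p → Fin m) : Set where
  constructor _,_
  field
    bijection  : Permutation n p
    compatible : ∀ j → e (bijection ⟨$⟩ʳ j) ≡ d j

open ColorBijection

colorBijectionSetoid : (Fin n → Fin m) → (Fin p → Fin m) → Setoid 0ℓ 0ℓ
colorBijectionSetoid d e = record
  { Carrier       = ColorBijection d e
  ; _≈_           = λ b c → bijection b ⟨$⟩ʳ_ ≗ bijection c ⟨$⟩ʳ_
  ; isEquivalence = record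
    { refl  = λ _ → refl
    ; sym   = λ b≈c j → sym (b≈c j)
    ; trans = λ b≈c c≈d j → trans (b≈c j) (c≈d j)
    }
  }

module _ (d : Fin (suc n) → Fin m) (e : Fin (suc p) → Fin m) where

  image-zero : ColorBijection d e → Fin (suc p)
  image-zero b = bijection b ⟨$⟩ʳ zero

  fibre↔remove : ∀ x → e x ≡ d zero →
    Inverse (fibreSetoid (colorBijectionSetoid d e) image-zero x)
            (colorBijectionSetoid (d ∘ suc) (e ∘ punchIn x))
  fibre↔remove x ex≡d0 = record
    { to        = to
    ; from      = from
    ; to-cong   = λ {b} {c} b≈c j → punchIn-injective x _ _
        (trans (sym (punchIn-to b j)) (trans (b≈c (suc j)) (punchIn-to c j)))
    ; from-cong = λ {b} {c} b≈c → λ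
        { zero    → refl
        ; (suc j) → trans (from-suc b j) (trans (cong (punchIn x) (b≈c j)) (sym (from-suc c j)))
        }
    ; inverse   =
        (λ {b} {c} c≈ j → punchIn-injective x _ _
          (trans (sym (punchIn-to c j)) (trans (c≈ (suc j)) (from-suc b j))))
      , (λ {c} {b} b≈ → λ
        { zero    → sym (proj₂ c)
        ; (suc j) → trans (from-suc b j) (trans (cong (punchIn x) (b≈ j)) (sym (punchIn-to c j)))
        })
    }
    where
    Fibre = ∃[ b ] image-zero b ≡ x

    punchIn-to : ∀ ((b , _) : Fibre) j →
      bijection b ⟨$⟩ʳ suc j ≡ punchIn x (remove zero (bijection b) ⟨$⟩ʳ j)
    punchIn-to (b , refl) j = punchIn-permute (bijection b) zero j

    to : Fibre → ColorBijection (d ∘ suc) (e ∘ punchIn x)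
    to c@(b , _) = remove zero (bijection b) , λ j →
      trans (cong e (sym (punchIn-to c j))) (compatible b (suc j))

    from-suc : ∀ (b : ColorBijection (d ∘ suc) (e ∘ punchIn x)) j →
      insert zero x (bijection b) ⟨$⟩ʳ suc j ≡ punchIn x (bijection b ⟨$⟩ʳ j)
    from-suc b j = insert-punchIn zero x (bijection b) j

    from : ColorBijection (d ∘ suc) (e ∘ punchIn x) → Fibre
    from b = (insert zero x (bijection b) , λ
      { zero    → ex≡d0
      ; (suc j) → trans (cong e (from-suc b j)) (compatible b j)
      }) , refl

factorials : MultiIndex m → ℕ
factorials α = Vec.foldr′ ℕ._*_ 1 (Vec.map _! α)

factorials-%=suc : ∀ (i : Fin m) α →
  factorials (α [ i ]%= suc) ≡ suc (lookup α i) ℕ.* factorials α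
factorials-%=suc zero    (a ∷ α) = ℕ.*-assoc (suc a) (a !) (factorials α)
factorials-%=suc (suc i) (a ∷ α) = begin
  a ! ℕ.* factorials (α [ i ]%= suc)                ≡⟨ cong (a ! ℕ.*_) (factorials-%=suc i α) ⟩
  a ! ℕ.* (suc (lookup α i) ℕ.* factorials α)
    ≡⟨ ℕ.*-assoc (a !) (suc (lookup α i)) (factorials α) ⟨
  (a ! ℕ.* suc (lookup α i)) ℕ.* factorials α
    ≡⟨ cong (ℕ._* factorials α) (ℕ.*-comm (a !) _) ⟩
  (suc (lookup α i) ℕ.* a !) ℕ.* factorials α
    ≡⟨ ℕ.*-assoc (suc (lookup α i)) (a !) (factorials α) ⟩
  suc (lookup α i) ℕ.* (a ! ℕ.* factorials α)       ∎

factorials-0 : ∀ m → factorials (tabulate {n = m} λ _ → 0) ≡ 1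
factorials-0 zero    = refl
factorials-0 (suc m) = trans (ℕ.*-identityˡ _) (factorials-0 m)

bijectionCount : (Fin n → Fin m) → (Fin p → Fin m) → ℕ
bijectionCount d e =
  if does (≡-dec ℕ._≟_ (fibreSizes e) (fibreSizes d)) then factorials (fibreSizes d) else 0

bijectionCount-≡ : ∀ (d : Fin n → Fin m) (e : Fin p → Fin m) →
  fibreSizes e ≡ fibreSizes d → bijectionCount d e ≡ factorials (fibreSizes d)
bijectionCount-≡ d e eq = cong (if_then factorials (fibreSizes d) else 0)
  (dec-true (≡-dec ℕ._≟_ (fibreSizes e) (fibreSizes d)) eq)

bijectionCount-≢ : ∀ (d : Fin n → Fin m) (e : Fin p → Fin m) →
  fibreSizes e ≢ fibreSizes d → bijectionCount d e ≡ 0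
bijectionCount-≢ d e neq = cong (if_then factorials (fibreSizes d) else 0)
  (dec-false (≡-dec ℕ._≟_ (fibreSizes e) (fibreSizes d)) neq)

fibreSizes-suc≢0 : ∀ (d : Fin (suc n) → Fin m) (e : Fin 0 → Fin m) →
                   fibreSizes e ≢ fibreSizes d
fibreSizes-suc≢0 d e eq =
  %=suc-≢ (d zero) (lookup∘tabulate (λ _ → 0) (d zero)) (trans eq (fibreSizes-suc d))

sumℕ-fibre : ∀ (e : Fin p → Fin m) i N →
  sumℕ (λ x → if does (e x ≟ i) then N else 0) ≡ ∣ fibre e i ∣ ℕ.* N
sumℕ-fibre {zero}  e i N = refl
sumℕ-fibre {suc p} e i N with does (e zero ≟ i)
... | true  = cong (N ℕ.+_) (sumℕ-fibre (e ∘ suc) i N)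
... | false = sumℕ-fibre (e ∘ suc) i N

module _ (d : Fin (suc n) → Fin m) (e : Fin (suc p) → Fin m) where

  fibreSizes-remove : ∀ x → e x ≡ d zero → fibreSizes e ≡ fibreSizes d →
                      fibreSizes (e ∘ punchIn x) ≡ fibreSizes (d ∘ suc)
  fibreSizes-remove x ex≡d0 eq = %=suc-injective (d zero) (begin
    fibreSizes (e ∘ punchIn x) [ d zero ]%= suc
      ≡⟨ cong (fibreSizes (e ∘ punchIn x) [_]%= suc) ex≡d0 ⟨
    fibreSizes (e ∘ punchIn x) [ e x ]%= suc    ≡⟨ fibreSizes-punchIn e x ⟨
    fibreSizes e                                ≡⟨ eq ⟩
    fibreSizes d                                ≡⟨ fibreSizes-suc d ⟩
    fibreSizes (d ∘ suc) [ d zero ]%= suc       ∎)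

  fibreSizes-insert : ∀ x → e x ≡ d zero →
                      fibreSizes (e ∘ punchIn x) ≡ fibreSizes (d ∘ suc) →
                      fibreSizes e ≡ fibreSizes d
  fibreSizes-insert x ex≡d0 eq = begin
    fibreSizes e                             ≡⟨ fibreSizes-punchIn e x ⟩
    fibreSizes (e ∘ punchIn x) [ e x ]%= suc ≡⟨ cong₂ (λ α i → α [ i ]%= suc) eq ex≡d0 ⟩
    fibreSizes (d ∘ suc) [ d zero ]%= suc    ≡⟨ fibreSizes-suc d ⟨
    fibreSizes d                             ∎

  bijectionCount-suc : bijectionCount d e ≡
    sumℕ λ x → if does (e x ≟ d zero) then bijectionCount (d ∘ suc) (e ∘ punchIn x) else 0
  bijectionCount-suc = by-cases (≡-dec ℕ._≟_ (fibreSizes e) (fibreSizes d))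
    where
    δ = fibreSizes (d ∘ suc)

    count : Fin (suc p) → ℕ
    count x = if does (e x ≟ d zero) then bijectionCount (d ∘ suc) (e ∘ punchIn x) else 0

    by-cases : Dec (fibreSizes e ≡ fibreSizes d) → bijectionCount d e ≡ sumℕ count
    by-cases (yes eq) = begin
      bijectionCount d e
        ≡⟨ bijectionCount-≡ d e eq ⟩
      factorials (fibreSizes d)
        ≡⟨ cong factorials (fibreSizes-suc d) ⟩
      factorials (δ [ d zero ]%= suc)
        ≡⟨ factorials-%=suc (d zero) δ ⟩
      suc (lookup δ (d zero)) ℕ.* factorials δ
        ≡⟨ cong (ℕ._* factorials δ) fibre-size ⟨
      ∣ fibre e (d zero) ∣ ℕ.* factorials δ
        ≡⟨ sumℕ-fibre e (d zero) (factorials δ) ⟨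
      sumℕ (λ x → if does (e x ≟ d zero) then factorials δ else 0)    ≡⟨ sumℕ-cong term ⟩
      sumℕ count                                                      ∎
      where
      fibre-size : ∣ fibre e (d zero) ∣ ≡ suc (lookup δ (d zero))
      fibre-size = begin
        ∣ fibre e (d zero) ∣
          ≡⟨ lookup∘tabulate (λ i → ∣ fibre e i ∣) (d zero) ⟨
        lookup (fibreSizes e) (d zero)
          ≡⟨ cong (λ α → lookup α (d zero)) (trans eq (fibreSizes-suc d)) ⟩
        lookup (δ [ d zero ]%= suc) (d zero)   ≡⟨ lookup∘updateAt (d zero) δ ⟩
        suc (lookup δ (d zero))                ∎

      term : ∀ x → (if does (e x ≟ d zero) then factorials δ else 0) ≡ count x
      term x with e x ≟ d zero
      ... | yes ex≡d0 =
        sym (bijectionCount-≡ (d ∘ suc) (e ∘ punchIn x) (fibreSizes-remove x ex≡d0 eq))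
      ... | no  _     = refl
    by-cases (no neq) = begin
      bijectionCount d e        ≡⟨ bijectionCount-≢ d e neq ⟩
      0                         ≡⟨ sumℕ-zero (suc p) ⟨
      sumℕ {suc p} (λ _ → 0)    ≡⟨ sumℕ-cong term ⟩
      sumℕ count                ∎
      where
      term : ∀ x → 0 ≡ count x
      term x with e x ≟ d zero
      ... | yes ex≡d0 = sym (bijectionCount-≢ (d ∘ suc) (e ∘ punchIn x)
                                              (neq ∘ fibreSizes-insert x ex≡d0))
      ... | no  _     = refl

hasCardinality-≡ : ∀ {S : Setoid a ℓ} {M N} → M ≡ N → HasCardinality S M → HasCardinality S N
hasCardinality-≡ refl I = I

colorBijection-cardinality : ∀ (d : Fin n → Fin m) (e : Fin p → Fin m) →
  HasCardinality (colorBijectionSetoid d e) (bijectionCount d e)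
colorBijection-cardinality {zero} {m} {zero} d e =
  hasCardinality-≡ (sym (trans (bijectionCount-≡ d e refl) (factorials-0 m))) record
    { to        = λ _ → zero
    ; from      = λ _ → ↔-id _ , λ ()
    ; to-cong   = λ _ → refl
    ; from-cong = λ _ ()
    ; inverse   = (λ { {zero} _ → refl }) , λ _ ()
    }
colorBijection-cardinality {zero} {m} {suc p} d e =
  hasCardinality-≡ (sym (bijectionCount-≢ d e (fibreSizes-suc≢0 e d ∘ sym)))
    (hasCardinality-empty (colorBijectionSetoid d e) λ b → refute (λ ()) (bijection b))
colorBijection-cardinality {suc n} {m} {zero} d e =
  hasCardinality-≡ (sym (bijectionCount-≢ d e (fibreSizes-suc≢0 d e)))
    (hasCardinality-empty (colorBijectionSetoid d e) λ b → refute (λ ()) (bijection b))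
colorBijection-cardinality {suc n} {m} {suc p} d e =
  hasCardinality-≡ (sym (bijectionCount-suc d e))
    (hasCardinality-sum S (image-zero d e) (λ b≈c → b≈c zero) fibre-cardinality)
  where
  S = colorBijectionSetoid d e

  fibre-cardinality : ∀ x → HasCardinality (fibreSetoid S (image-zero d e) x)
    (if does (e x ≟ d zero) then bijectionCount (d ∘ suc) (e ∘ punchIn x) else 0)
  fibre-cardinality x with e x ≟ d zero
  ... | yes ex≡d0 = Composition.inverse (fibre↔remove d e x ex≡d0)
                      (colorBijection-cardinality (d ∘ suc) (e ∘ punchIn x))
  ... | no  ex≢d0 = hasCardinality-empty (fibreSetoid S (image-zero d e) x)
                      λ { (b , refl) → ex≢d0 (compatible b zero) }

funToFin-cong : ∀ {f g : Fin k → Fin n} → f ≗ g → funToFin f ≡ funToFin g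
funToFin-cong {zero}  f≗g = refl
funToFin-cong {suc k} f≗g = cong₂ combine (f≗g zero) (funToFin-cong (f≗g ∘ suc))

colors : (C : ColoredSet k) → Fin (ColoredSet.size C) → Fin (suc k)
colors C = ColoredSet.κ C ∘ Inverse.to (ColoredSet.finite C)

module _ (n : ℕ) (C : ColoredSet k) where
  open ColoredSet C

  functionIndex : Matching n C → Fin (n ℕ.^ k)
  functionIndex M = funToFin (Matching.f M)

  fibre↔colorBijection : ∀ i →
    Inverse (fibreSetoid (matchingSetoid n C) functionIndex i)
            (colorBijectionSetoid (fibreSize (finToFun {n} {k} i)) (colors C))
  fibre↔colorBijection i = record
    { to        = to
    ; from      = from
    ; to-cong   = λ (_ , h≗h′) j → cong (Inverse.from finite) (h≗h′ j)
    ; from-cong = λ b≈c → (λ _ → refl) , λ j → cong (Inverse.to finite) (b≈c j)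
    ; inverse   =
        (λ {b} {M} (_ , h≗) j → trans (cong (Inverse.from finite) (h≗ j))
          (Inverse.strictlyInverseʳ finite (bijection b ⟨$⟩ʳ j)))
      , (λ {M} {b} b≈ → f≗ M , λ j → trans (cong (Inverse.to finite) (b≈ j))
          (Inverse.strictlyInverseˡ finite (Bijection.to (Matching.h (proj₁ M)) j)))
    }
    where
    Fibre = ∃[ M ] functionIndex M ≡ i

    f≗ : ∀ ((M , _) : Fibre) → finToFun i ≗ Matching.f M
    f≗ (M , refl) = finToFun-funToFin (Matching.f M)

    to : Fibre → ColorBijection (fibreSize (finToFun {n} {k} i)) (colors C)
    to c@(M , _) = Composition.inverse (⤖⇒↔ h) (Symmetry.inverse finite) , λ j → begin
      κ (Inverse.to finite (Inverse.from finite (Bijection.to h j)))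
        ≡⟨ cong κ (Inverse.strictlyInverseˡ finite (Bijection.to h j)) ⟩
      κ (Bijection.to h j)            ≡⟨ Matching.compatible M j ⟩
      fibreSize (Matching.f M) j      ≡⟨ fibreSize-cong (f≗ c) j ⟨
      fibreSize (finToFun {n} {k} i) j ∎
      where open Matching M using (h)

    from : ColorBijection (fibreSize (finToFun {n} {k} i)) (colors C) → Fibre
    from b = record
      { f          = finToFun {n} {k} i
      ; h          = ↔⇒⤖ (Composition.inverse (bijection b) finite)
      ; compatible = compatible b
      } , funToFin-finToFin {k} {n} i

  matchingCount : ℕ
  matchingCount = sumℕ λ i → bijectionCount (fibreSize (finToFun {n} {k} i)) (colors C)

  matching-cardinality : HasCardinality (matchingSetoid n C) matchingCount
  matching-cardinality =
    hasCardinality-sum (matchingSetoid n C) functionIndex (λ (f≗g , _) → funToFin-cong f≗g)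
      λ i → Composition.inverse (fibre↔colorBijection i)
        (colorBijection-cardinality (fibreSize (finToFun {n} {k} i)) (colors C))

fromℕ-sum : ∀ (N : Fin n → ℕ) → fromℕ (sumℕ N) ≡ sumℚ (fromℕ ∘ N)
fromℕ-sum {zero}  N = refl
fromℕ-sum {suc n} N =
  trans (fromℕ-+ (N zero) (sumℕ (N ∘ suc))) (cong (fromℕ (N zero) ℚ.+_) (fromℕ-sum (N ∘ suc)))

expCoefficient-monomial : ∀ (d : Fin n → Fin m) (e : Fin p → Fin m) →
  fromℕ (factorials (fibreSizes e)) ℚ.* monomial (fibreSizes d) (fibreSizes e)
    ≡ fromℕ (bijectionCount d e)
expCoefficient-monomial d e = by-cases (≡-dec ℕ._≟_ (fibreSizes e) (fibreSizes d))
  where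
  c = fromℕ (factorials (fibreSizes e))

  by-cases : Dec (fibreSizes e ≡ fibreSizes d) →
    c ℚ.* monomial (fibreSizes d) (fibreSizes e) ≡ fromℕ (bijectionCount d e)
  by-cases (yes eq) = begin
    c ℚ.* monomial (fibreSizes d) (fibreSizes e)
      ≡⟨ cong (λ α → c ℚ.* monomial α (fibreSizes e)) eq ⟨
    c ℚ.* monomial (fibreSizes e) (fibreSizes e) ≡⟨ cong (c ℚ.*_) (monomial-≡ (fibreSizes e)) ⟩
    c ℚ.* 1ℚ                                     ≡⟨ ℚ.*-identityʳ c ⟩
    c                                            ≡⟨ cong (fromℕ ∘ factorials) eq ⟩
    fromℕ (factorials (fibreSizes d))            ≡⟨ cong fromℕ (bijectionCount-≡ d e eq) ⟨
    fromℕ (bijectionCount d e)                   ∎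
  by-cases (no neq) = begin
    c ℚ.* monomial (fibreSizes d) (fibreSizes e)
      ≡⟨ cong (c ℚ.*_) (monomial-≢ (fibreSizes d) (fibreSizes e) neq) ⟩
    c ℚ.* 0ℚ                                     ≡⟨ ℚ.*-zeroʳ c ⟩
    0ℚ                                           ≡⟨ cong fromℕ (bijectionCount-≢ d e neq) ⟨
    fromℕ (bijectionCount d e)                   ∎

Δ-power-coefficient : ∀ n (C : ColoredSet k) →
  (Δ k (var zero ^ n) [[ C ]]) ≡ fromℕ (matchingCount n C)
Δ-power-coefficient {k} n C = begin
  c ℚ.* Δ k (var zero ^ n) γ
    ≡⟨ cong (c ℚ.*_) (trans (Δ-power k n γ)
         (sum-coefficient {n = n ℕ.^ k} (λ i → weight (finToFun {n} {k} i)) γ)) ⟩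
  c ℚ.* sumℚ {n ℕ.^ k} (λ i → weight (finToFun {n} {k} i) γ)
    ≡⟨ *-distribˡ-sumℚ {n ℕ.^ k} c (λ i → weight (finToFun {n} {k} i) γ) ⟩
  sumℚ {n ℕ.^ k} (λ i → c ℚ.* weight (finToFun {n} {k} i) γ)
    ≡⟨ sumℚ-cong {n ℕ.^ k} (λ i → trans
         (cong (c ℚ.*_) (weight-monomial (finToFun {n} {k} i) γ))
         (expCoefficient-monomial (fibreSize (finToFun {n} {k} i)) (colors C))) ⟩
  sumℚ {n ℕ.^ k} (λ i → fromℕ (bijectionCount (fibreSize (finToFun {n} {k} i)) (colors C)))
    ≡⟨ fromℕ-sum {n ℕ.^ k} (λ i → bijectionCount (fibreSize (finToFun {n} {k} i)) (colors C)) ⟨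
  fromℕ (matchingCount n C) ∎
  where
  γ = fibreSizes (colors C)
  c = fromℕ (factorials γ)

corollary3 : (k n : ℕ) → 1 ≤ k → 1 ≤ n →
    (Δ k (var zero ^ n) ≗ sumOverFunctions k n weight)
    × ((C : ColoredSet k) →
    ∃[ N ] (HasCardinality (matchingSetoid n C) N
    × (Δ k (var zero ^ n) [[ C ]]) ≡ fromℕ N))
corollary3 k n _ _ =
  Δ-power k n , λ C → matchingCount n C , matching-cardinality n C , Δ-power-coefficient n C
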